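{- For $n\ge0$ let $A_n=\sum_{r=0}^n n!/r!$ (so $A_n/n!=\sum_{r=0}^n 1/r!$), let $d_n=\gcd(A_n,n!)$, let $N_n=A_n/d_n$ be the numerator of $\sum_{r=0}^n1/r!$ in lowest terms, and let $R_n=\gcd(N_n,N_{n+2})$. Let $$P^{\ast}=\{p \text{ prime} : 0!-1!+2!-3!+\cdots+(-1)^{p-1}(p-1)!\equiv 0 \pmod p\}.$$ Then the terms of the sequence $R_0,R_1,\dots$ are ones and all the primes of $P^\ast$. More precisely: $R_1=2$; for every odd $p\in P^{\ast}$, $R_{p-3}=p$; and $R_n=1$ for all other $n\ge 0$. -}

module Defs where

open import Data.Integer.Base as ℤ using (ℤ; +_; 0ℤ; -1ℤ)
import Data.Integer.Divisibility as ℤ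
open import Data.List.Base using (foldr; map; upTo)
open import Data.Nat.Base using (ℕ; suc; _+_; _/_; _!; NonZero; ≢-nonZero; ≢-nonZero⁻¹)
open import Data.Nat.Divisibility using (_∣_)
open import Data.Nat.GCD using (gcd; gcd[m,n]≢0)
open import Data.Nat.ListAction using (sum)
open import Data.Nat.Primality using (Prime)
open import Data.Nat.Properties using (_!≢0)
open import Data.Product.Base using (_×_)
open import Data.Sum.Base using (inj₂)
open import Relation.Nullary.Negation.Core using (¬_)

-- The division is exact, since r ≤ n throughout the sum.
A : ℕ → ℕ
A n = sum (map (λ r → (n ! / r !) {{r !≢0}}) (upTo (suc n)))

d : ℕ → ℕ
d n = gcd (A n) (n !)

d≢0 : ∀ n → NonZero (d n)
d≢0 n = ≢-nonZero (gcd[m,n]≢0 (A n) (n !) (inj₂ (≢-nonZero⁻¹ (n !) {{n !≢0}})))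

-- The numerator of Σ_{r ≤ n} 1/r! = A n / n! in lowest terms.
N : ℕ → ℕ
N n = (A n / d n) {{d≢0 n}}

R : ℕ → ℕ
R n = gcd (N n) (N (2 + n))

-- 0! - 1! + 2! - ⋯ + (-1)^(p-1) (p-1)!
alternatingFactorialSum : ℕ → ℤ
alternatingFactorialSum p =
  foldr ℤ._+_ 0ℤ (map (λ k → -1ℤ ℤ.^ k ℤ.* + (k !)) (upTo p))

P* : ℕ → Set
P* p = Prime p × (+ p) ℤ.∣ alternatingFactorialSum p

Odd : ℕ → Set
Odd n = ¬ (2 ∣ n)

{-# OPTIONS --safe #-}

-- Write A n / n! = N n / D n in lowest terms.  From A (n+1) = (n+1) A n + 1,
--   A (n+2) = (n+2)(n+1) A n + (n+3),
-- so N (n+2) / D (n+2) - N n / D n = (n+3) / (n+2)!.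
-- If n+3 divides (n+2)!, the right-hand side is 1/t with t a natural number, and
-- clearing denominators shows that R n divides D n D (n+2), to which it is
-- coprime; thus R n = 1.  This covers every composite n+3 except 4, i.e. n = 1.
-- If n+3 = p is prime, then p does not divide (n+2)!, so R n divides p, with
-- R n = p iff p divides A n, iff p divides A (p-1).  Finally
-- A (p-1) = Σ_k (p-1)(p-2)⋯(p-k) ≡ Σ_k (-1)^k k! modulo p.

module Submission where

open import Defs
open import Data.Integer.Base as ℤ using (ℤ; +_; 0ℤ; 1ℤ; -1ℤ)
import Data.Integer.Divisibility as ℤᵤ
import Data.Integer.Divisibility.Signed as ℤ
import Data.Integer.Properties as ℤ
import Data.Integer.Tactic.RingSolver as ℤ-Solver
open import Data.List.Base using ([]; _∷_; _∷ʳ_; _++_; foldr; map; upTo)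
open import Data.List.Properties using (map-++; map-cong-local; upTo-∷ʳ)
import Data.List.Relation.Unary.All as All
open import Data.List.Relation.Unary.All.Properties using (all-upTo)
open import Data.Nat.Base
  using (ℕ; zero; suc; _+_; _*_; _∸_; _/_; _!; _≤_; _<_; z≤n; s≤s; s≤s⁻¹; NonZero;
         nonTrivial⇒n>1; nonTrivial⇒nonZero; >-nonZero)
open import Data.Nat.Coprimality using (Coprime; coprime-divisor; coprime-/gcd)
open import Data.Nat.Divisibility
open import Data.Nat.DivMod using (*-/-assoc; n/n≡1; m/n*n≡m)
open import Data.Nat.GCD using (gcd[m,n]∣m; gcd[m,n]∣n; gcd-greatest)
open import Data.Nat.ListAction using (sum)
open import Data.Nat.ListAction.Properties using (sum-++)
open import Data.Nat.Primality
open import Data.Nat.Properties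
open import Data.Nat.Tactic.RingSolver using (solve-∀)
open import Data.Product.Base using (_×_; _,_; proj₁; ∃-syntax)
open import Data.Sum.Base as Sum using (_⊎_; inj₁; inj₂; [_,_]′)
open import Function.Base using (_∘_; id; case_of_)
open import Function.Bundles using (_⇔_; mk⇔; Equivalence)
open import Relation.Binary.Definitions using (tri<; tri≈; tri>)
open import Relation.Binary.PropositionalEquality
  using (_≡_; _≢_; refl; sym; trans; cong; cong₂; subst; module ≡-Reasoning)
open import Relation.Nullary.Decidable using (yes; no)
open import Relation.Nullary.Negation.Core using (contradiction)

-- Divisors of factorials.

m<n≤o⇒m*n∣o! : ∀ {m n o} .{{_ : NonZero m}} → m < n → n ≤ o → m * n ∣ o !
m<n≤o⇒m*n∣o! {suc m} {suc n} (s≤s m<n) n≤o = ∣-trans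
  (subst (_∣ suc n !) (*-comm (suc n) (suc m))
    (*-monoʳ-∣ (suc n) (∣-trans (m∣m*n (m !)) (m≤n⇒m!∣n! m<n))))
  (m≤n⇒m!∣n! n≤o)

-- In a factorization `b * a` with distinct factors, both occur separately in `m !`. For a square,
-- `b` and `2 * b` do so instead, since `2 * b < b * b` once `b > 2`; the square of 2 is the
-- exception.
composite⇒∣! : ∀ {m} → Composite (suc m) → suc m ≢ 4 → suc m ∣ m !
composite⇒∣! {m} (composite {a} (s≤s a≤m) (divides b sm≡b*a)) sm≢4 with <-cmp b a
... | tri> _ _ a<b = subst (_∣ m !) (trans (*-comm a b) (sym sm≡b*a)) (m<n≤o⇒m*n∣o! a<b b≤m)
  where
  instance
    a≢0 : NonZero a
    a≢0 = nonTrivial⇒nonZero a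
    b≢0 : NonZero b
    b≢0 = >-nonZero (≤-<-trans z≤n a<b)
  b≤m : b ≤ m
  b≤m = s≤s⁻¹ (subst (b <_) (sym sm≡b*a) (m<m*n b a (nonTrivial⇒n>1 a)))
... | tri< b<a _ _ = subst (_∣ m !) (sym sm≡b*a) (m<n≤o⇒m*n∣o! {{b≢0}} b<a a≤m)
  where
  b≢0 : NonZero b
  b≢0 = m*n≢0⇒m≢0 b {{subst NonZero sm≡b*a _}}
... | tri≈ _ refl _ = ∣-trans
  (subst (_∣ b * (2 * b)) (sym sm≡b*a) (*-monoʳ-∣ b (n∣m*n 2)))
  (m<n≤o⇒m*n∣o! b<2*b 2*b≤m)
  where
  instance
    b≢0 : NonZero b
    b≢0 = nonTrivial⇒nonZero b
  b≢2 : b ≢ 2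
  b≢2 refl = sm≢4 sm≡b*a
  b<2*b : b < 2 * b
  b<2*b = subst (b <_) (*-comm b 2) (m<m*n b 2 (s≤s (s≤s z≤n)))
  2*b≤m : 2 * b ≤ m
  2*b≤m = s≤s⁻¹ (subst (2 * b <_) (sym sm≡b*a)
    (*-monoˡ-< b (≤∧≢⇒< (nonTrivial⇒n>1 b) (b≢2 ∘ sym))))

prime∤! : ∀ {p n} → Prime p → n < p → p ∤ n !
prime∤! {n = zero}  pp n<p p∣1 = ¬prime[1] (subst Prime (∣1⇒≡1 p∣1) pp)
prime∤! {n = suc n} pp n<p p∣n! with euclidsLemma (suc n) (n !) pp p∣n!
... | inj₁ p∣sn  = >⇒∤ n<p p∣sn
... | inj₂ p∣n!′ = prime∤! pp (<-trans (n<1+n n) n<p) p∣n!′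

-- Finite sums and the recurrence for `A`.

sum-map-* : ∀ {ℓ} {X : Set ℓ} k (f : X → ℕ) xs → sum (map (λ x → k * f x) xs) ≡ k * sum (map f xs)
sum-map-* k f []       = sym (*-zeroʳ k)
sum-map-* k f (x ∷ xs) = trans (cong (λ s → k * f x + s) (sum-map-* k f xs)) (sym (*-distribˡ-+ k (f x) _))

sum-map-upTo-suc : ∀ (f : ℕ → ℕ) n → sum (map f (upTo (suc n))) ≡ sum (map f (upTo n)) + f n
sum-map-upTo-suc f n = begin
  sum (map f (upTo (suc n)))              ≡⟨ cong (sum ∘ map f) (upTo-∷ʳ n) ⟨
  sum (map f (upTo n ∷ʳ n))               ≡⟨ cong sum (map-++ f (upTo n) (n ∷ [])) ⟩
  sum (map f (upTo n) ++ (f n ∷ []))      ≡⟨ sum-++ (map f (upTo n)) (f n ∷ []) ⟩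
  sum (map f (upTo n)) + (f n + 0)        ≡⟨ cong (λ y → sum (map f (upTo n)) + y) (+-identityʳ (f n)) ⟩
  sum (map f (upTo n)) + f n              ∎
  where open ≡-Reasoning

A-suc : ∀ n → A (suc n) ≡ suc n * A n + 1
A-suc n = begin
  A (suc n)
    ≡⟨ sum-map-upTo-suc (term (suc n)) (suc n) ⟩
  sum (map (term (suc n)) (upTo (suc n))) + term (suc n) (suc n)
    ≡⟨ cong₂ _+_ (cong sum (map-cong-local (All.map scale (all-upTo (suc n)))))
                 (n/n≡1 (suc n !) {{suc n !≢0}}) ⟩
  sum (map (λ r → suc n * term n r) (upTo (suc n))) + 1
    ≡⟨ cong (_+ 1) (sum-map-* (suc n) (term n) (upTo (suc n))) ⟩
  suc n * A n + 1
    ∎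
  where
  open ≡-Reasoning
  term : ℕ → ℕ → ℕ
  term n r = (n ! / r !) {{r !≢0}}
  -- The factor `suc n` passes through the truncating division because `r !` divides `n !`.
  scale : ∀ {r} → r < suc n → term (suc n) r ≡ suc n * term n r
  scale {r} (s≤s r≤n) = *-/-assoc (suc n) {{r !≢0}} (m≤n⇒m!∣n! r≤n)

A-2+ : ∀ n → A (2 + n) ≡ (2 + n) * (1 + n) * A n + (3 + n)
A-2+ n = begin
  A (2 + n)                            ≡⟨ A-suc (1 + n) ⟩
  (2 + n) * A (1 + n) + 1              ≡⟨ cong (λ a → (2 + n) * a + 1) (A-suc n) ⟩
  (2 + n) * ((1 + n) * A n + 1) + 1    ≡⟨ identity n (A n) ⟩
  (2 + n) * (1 + n) * A n + (3 + n)    ∎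
  where
  open ≡-Reasoning
  identity : ∀ n a → (2 + n) * ((1 + n) * a + 1) + 1 ≡ (2 + n) * (1 + n) * a + (3 + n)
  identity = solve-∀

-- Numerators and denominators in lowest terms.

D : ℕ → ℕ
D n = (n ! / d n) {{d≢0 n}}

N*d≡A : ∀ n → N n * d n ≡ A n
N*d≡A n = m/n*n≡m {{d≢0 n}} (gcd[m,n]∣m (A n) (n !))

D*d≡! : ∀ n → D n * d n ≡ n !
D*d≡! n = m/n*n≡m {{d≢0 n}} (gcd[m,n]∣n (A n) (n !))

coprime-N-D : ∀ n → Coprime (N n) (D n)
coprime-N-D n = coprime-/gcd (A n) (n !) {{d≢0 n}}

N∣A : ∀ n → N n ∣ A n
N∣A n = divides (d n) (trans (sym (N*d≡A n)) (*-comm (N n) (d n)))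

R∣N : ∀ n → R n ∣ N n
R∣N n = gcd[m,n]∣m (N n) (N (2 + n))

R∣N-2+ : ∀ n → R n ∣ N (2 + n)
R∣N-2+ n = gcd[m,n]∣n (N n) (N (2 + n))

-- `R n` divides both `A n` and `A (2 + n)`, hence the inhomogeneous term of `A-2+`.
R∣3+n : ∀ n → R n ∣ 3 + n
R∣3+n n = ∣m+n∣m⇒∣n
  (subst (R n ∣_) (A-2+ n) (∣-trans (R∣N-2+ n) (N∣A (2 + n))))
  (∣n⇒∣m*n ((2 + n) * (1 + n)) (∣-trans (R∣N n) (N∣A n)))

-- N (2+n) / D (2+n) = N n / D n + 1/t, with denominators cleared.
cross-difference : ∀ n t → (2 + n) ! ≡ t * (3 + n) →
  t * N (2 + n) * D n ≡ t * N n * D (2 + n) + D (2 + n) * D n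
-- Multiplying by `d (2 + n)` turns `N (2 + n)` into `A (2 + n)`, to which the recurrence applies.
cross-difference n t fact = *-cancelʳ-≡ _ _ (d (2 + n)) {{d≢0 (2 + n)}} (begin
  t * N₂ * D₀ * d₂
    ≡⟨ identity₁ t N₂ D₀ d₂ ⟩
  t * D₀ * (N₂ * d₂)
    ≡⟨ cong (t * D₀ *_) (trans (N*d≡A (2 + n)) (A-2+ n)) ⟩
  t * D₀ * ((2 + n) * (1 + n) * A n + (3 + n))
    ≡⟨ cong (λ a → t * D₀ * ((2 + n) * (1 + n) * a + (3 + n))) (N*d≡A n) ⟨
  t * D₀ * ((2 + n) * (1 + n) * (N₀ * d₀) + (3 + n))
    ≡⟨ identity₂ n t D₀ N₀ d₀ ⟩
  t * N₀ * ((2 + n) * ((1 + n) * (D₀ * d₀))) + t * (3 + n) * D₀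
    ≡⟨ cong₂ (λ x y → t * N₀ * ((2 + n) * ((1 + n) * x)) + y * D₀) (D*d≡! n) (sym fact) ⟩
  t * N₀ * (2 + n) ! + (2 + n) ! * D₀
    ≡⟨ cong (λ x → t * N₀ * x + x * D₀) (D*d≡! (2 + n)) ⟨
  t * N₀ * (D₂ * d₂) + D₂ * d₂ * D₀
    ≡⟨ identity₃ t N₀ D₂ d₂ D₀ ⟩
  (t * N₀ * D₂ + D₂ * D₀) * d₂
    ∎)
  where
  open ≡-Reasoning
  N₀ = N n
  D₀ = D n
  d₀ = d n
  N₂ = N (2 + n)
  D₂ = D (2 + n)
  d₂ = d (2 + n)
  identity₁ : ∀ t N D d → t * N * D * d ≡ t * D * (N * d)
  identity₁ = solve-∀
  identity₂ : ∀ n t D N d → t * D * ((2 + n) * (1 + n) * (N * d) + (3 + n))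
    ≡ t * N * ((2 + n) * ((1 + n) * (D * d))) + t * (3 + n) * D
  identity₂ = solve-∀
  identity₃ : ∀ t N D d E → t * N * (D * d) + D * d * E ≡ (t * N * D + D * E) * d
  identity₃ = solve-∀

3+n∣[2+n]!⇒R≡1 : ∀ n → 3 + n ∣ (2 + n) ! → R n ≡ 1
3+n∣[2+n]!⇒R≡1 n (divides t fact) = coprime-N-D n (R∣N n , R∣D)
  where
  R∣D*D : R n ∣ D (2 + n) * D n
  R∣D*D = ∣m+n∣m⇒∣n
    (subst (R n ∣_) (cross-difference n t fact) (∣m⇒∣m*n (D n) (∣n⇒∣m*n t (R∣N-2+ n))))
    (∣m⇒∣m*n (D (2 + n)) (∣n⇒∣m*n t (R∣N n)))
  R∣D : R n ∣ D n
  -- As a divisor of `N (2 + n)`, `R n` is coprime to `D (2 + n)`, so that factor drops out.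
  R∣D = coprime-divisor
    (λ { (i∣R , i∣D) → coprime-N-D (2 + n) (∣-trans i∣R (R∣N-2+ n) , i∣D) }) R∣D*D

-- The alternating factorial sum modulo `suc n`.

signedFactorial : ℕ → ℤ
signedFactorial k = -1ℤ ℤ.^ k ℤ.* + (k !)

foldr-+-∷ʳ : ∀ xs y → foldr ℤ._+_ 0ℤ (xs ∷ʳ y) ≡ foldr ℤ._+_ 0ℤ xs ℤ.+ y
foldr-+-∷ʳ []       y = ℤ.+-comm y 0ℤ
foldr-+-∷ʳ (x ∷ xs) y = trans (cong (λ s → x ℤ.+ s) (foldr-+-∷ʳ xs y)) (sym (ℤ.+-assoc x _ y))

alternatingFactorialSum-suc : ∀ n →
  alternatingFactorialSum (suc n) ≡ alternatingFactorialSum n ℤ.+ signedFactorial n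
alternatingFactorialSum-suc n = begin
  foldr ℤ._+_ 0ℤ (map signedFactorial (upTo (suc n)))
    ≡⟨ cong (foldr ℤ._+_ 0ℤ ∘ map signedFactorial) (upTo-∷ʳ n) ⟨
  foldr ℤ._+_ 0ℤ (map signedFactorial (upTo n ∷ʳ n))
    ≡⟨ cong (foldr ℤ._+_ 0ℤ) (map-++ signedFactorial (upTo n) (n ∷ [])) ⟩
  foldr ℤ._+_ 0ℤ (map signedFactorial (upTo n) ∷ʳ signedFactorial n)
    ≡⟨ foldr-+-∷ʳ (map signedFactorial (upTo n)) (signedFactorial n) ⟩
  alternatingFactorialSum n ℤ.+ signedFactorial n
    ∎
  where open ≡-Reasoning

-- Unrolls A i = i A (i-1) + 1 downwards j times from i = n, where each factor
-- i = n - j is replaced by -(j+1).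
A-unroll : ∀ j i →
  + suc (i + j) ℤ.∣ + A (i + j) ℤ.- (alternatingFactorialSum j ℤ.+ signedFactorial j ℤ.* + A i)
A-unroll zero i = subst (+ suc (i + 0) ℤ.∣_) (sym difference≡0) (ℤ.divides 0ℤ refl)
  where
  identity : ∀ a → a ℤ.- (0ℤ ℤ.+ (1ℤ ℤ.* 1ℤ) ℤ.* a) ≡ 0ℤ
  identity = ℤ-Solver.solve-∀
  difference≡0 : + A (i + 0) ℤ.- (0ℤ ℤ.+ 1ℤ ℤ.* + A i) ≡ 0ℤ
  difference≡0 = trans (cong (λ k → + A k ℤ.- (0ℤ ℤ.+ 1ℤ ℤ.* + A i)) (+-identityʳ i)) (identity (+ A i))
-- The rewrite turns `i + suc j` into `suc i + j`, so the hypothesis at `j` and `suc i` has the same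
-- modulus and the same leading term.
A-unroll (suc j) i rewrite +-suc i j =
  subst (+ m ℤ.∣_) (sym difference) (ℤ.∣m∣n⇒∣m+n (A-unroll j (suc i)) (ℤ.∣m⇒∣m*n _ ℤ.∣-refl))
  where
  open ≡-Reasoning
  m = suc (suc i + j)
  S = alternatingFactorialSum j
  s = -1ℤ ℤ.^ j
  f = + (j !)
  a = + A i
  J = + j
  I = + i
  -- Replacing the factor `i + 1` by `-(j + 1)` changes the expression by a multiple of their
  -- difference `i + j + 2`, which is the modulus `m`.
  identity : ∀ x S s f a I J →
    x ℤ.- (S ℤ.+ s ℤ.* f ℤ.+ ((-1ℤ ℤ.* s) ℤ.* ((1ℤ ℤ.+ J) ℤ.* f)) ℤ.* a)
    ≡ x ℤ.- (S ℤ.+ (s ℤ.* f) ℤ.* ((1ℤ ℤ.+ I) ℤ.* a ℤ.+ 1ℤ))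
      ℤ.+ (1ℤ ℤ.+ (1ℤ ℤ.+ I ℤ.+ J)) ℤ.* (s ℤ.* f ℤ.* a)
  identity = ℤ-Solver.solve-∀
  A-sucℤ : + A (suc i) ≡ (1ℤ ℤ.+ I) ℤ.* a ℤ.+ 1ℤ
  A-sucℤ = trans (cong +_ (A-suc i)) (cong (λ x → x ℤ.+ 1ℤ) (ℤ.pos-* (suc i) (A i)))
  difference :
    + A (suc i + j) ℤ.- (alternatingFactorialSum (suc j) ℤ.+ signedFactorial (suc j) ℤ.* a)
    ≡ + A (suc i + j) ℤ.- (S ℤ.+ signedFactorial j ℤ.* + A (suc i)) ℤ.+ + m ℤ.* (s ℤ.* f ℤ.* a)
  difference = begin
    + A (suc i + j) ℤ.- (alternatingFactorialSum (suc j) ℤ.+ signedFactorial (suc j) ℤ.* a)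
      ≡⟨ cong₂ (λ x y → + A (suc i + j) ℤ.- (x ℤ.+ -1ℤ ℤ.* s ℤ.* y ℤ.* a))
               (alternatingFactorialSum-suc j) (ℤ.pos-* (suc j) (j !)) ⟩
    _ ≡⟨ identity (+ A (suc i + j)) S s f a I J ⟩
    _ ≡⟨ cong (λ x → + A (suc i + j) ℤ.- (S ℤ.+ s ℤ.* f ℤ.* x) ℤ.+ + m ℤ.* (s ℤ.* f ℤ.* a)) A-sucℤ ⟨
    + A (suc i + j) ℤ.- (S ℤ.+ signedFactorial j ℤ.* + A (suc i)) ℤ.+ + m ℤ.* (s ℤ.* f ℤ.* a)
      ∎

-- Unrolling down to `A 0`, which is 1, leaves `signedFactorial n` as the remaining term, exactly
-- the last summand.
A≡alternatingFactorialSum : ∀ n → + suc n ℤ.∣ + A n ℤ.- alternatingFactorialSum (suc n)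
A≡alternatingFactorialSum n = subst (λ x → + suc n ℤ.∣ + A n ℤ.- x)
  (trans (cong (λ x → alternatingFactorialSum n ℤ.+ x) (ℤ.*-identityʳ (signedFactorial n)))
         (sym (alternatingFactorialSum-suc n)))
  (A-unroll n 0)

∣alternatingFactorialSum⇔∣A : ∀ n →
  (+ suc n ℤᵤ.∣ alternatingFactorialSum (suc n)) ⇔ suc n ∣ A n
∣alternatingFactorialSum⇔∣A n = mk⇔
  (λ h → ℤ.∣⇒∣ᵤ {i = + A n} (ℤ.∣m+n∣n⇒∣m (A≡alternatingFactorialSum n)
    (ℤ.∣m⇒∣-m (ℤ.∣ᵤ⇒∣ {i = alternatingFactorialSum (suc n)} h))))
  (λ h → ℤ.∣⇒∣ᵤ (subst (+ suc n ℤ.∣_) (ℤ.neg-involutive (alternatingFactorialSum (suc n)))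
    (ℤ.∣m⇒∣-m (ℤ.∣m+n∣m⇒∣n (A≡alternatingFactorialSum n) (ℤ.∣ᵤ⇒∣ {i = + A n} h)))))

-- Values of `R n`, according to whether `3 + n` is prime.

prime∣A⇒∣N : ∀ {p n} → Prime p → n < p → p ∣ A n → p ∣ N n
prime∣A⇒∣N {p} {n} pp n<p p∣A with euclidsLemma (N n) (d n) pp (subst (p ∣_) (sym (N*d≡A n)) p∣A)
... | inj₁ p∣N = p∣N
-- `d n` divides `n !`, all of whose prime factors are below `p`.
... | inj₂ p∣d = contradiction (∣-trans p∣d (gcd[m,n]∣n (A n) (n !))) (prime∤! pp n<p)

-- The prime `3 + n` divides `A (2 + n)`, hence by `A-2+` also `(2 + n) * (1 + n) * A n`. The first
-- two factors are too small, so it divides `A n`, and it survives in both numerators.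
P*⇒R≡3+n : ∀ n → P* (3 + n) → R n ≡ 3 + n
P*⇒R≡3+n n (pp , p∣alt) = ∣-antisym (R∣3+n n) (gcd-greatest
  (prime∣A⇒∣N pp (m≤n+m (1 + n) 2) p∣A)
  (prime∣A⇒∣N pp ≤-refl p∣A₂))
  where
  p∣A₂ : 3 + n ∣ A (2 + n)
  p∣A₂ = Equivalence.to (∣alternatingFactorialSum⇔∣A (2 + n)) p∣alt
  p∣[2+n]*[1+n]*A : 3 + n ∣ (2 + n) * (1 + n) * A n
  p∣[2+n]*[1+n]*A = ∣m+n∣m⇒∣n (subst (3 + n ∣_) (trans (A-2+ n) (+-comm _ (3 + n))) p∣A₂) ∣-refl
  p∣A : 3 + n ∣ A n
  p∣A = [ (λ h → [ (λ p∣2+n → contradiction p∣2+n (>⇒∤ ≤-refl))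
                 , (λ p∣1+n → contradiction p∣1+n (>⇒∤ (n≤1+n (2 + n)))) ]′
                 (euclidsLemma (2 + n) (1 + n) pp h))
        , id ]′
        (euclidsLemma ((2 + n) * (1 + n)) (A n) pp p∣[2+n]*[1+n]*A)

R-prime : ∀ n → Prime (3 + n) → R n ≡ 1 ⊎ (R n ≡ 3 + n × P* (3 + n))
R-prime n pp = Sum.map₂
  (λ R≡p → R≡p , pp , Equivalence.from (∣alternatingFactorialSum⇔∣A (2 + n))
    (∣-trans (subst (_∣ N (2 + n)) R≡p (R∣N-2+ n)) (N∣A (2 + n))))
  (prime⇒irreducible pp (R∣3+n n))

R-value : ∀ n → n ≢ 1 → R n ≡ 1 ⊎ (R n ≡ 3 + n × P* (3 + n))
R-value n n≢1 = case prime? (3 + n) of λ where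
  (yes pp) → R-prime n pp
  (no ¬pp) → inj₁ (3+n∣[2+n]!⇒R≡1 n (composite⇒∣! (¬prime⇒composite ¬pp) (n≢1 ∘ +-cancelˡ-≡ 3 n 1)))

prime⇒≡2∨odd : ∀ {p} → Prime p → p ≡ 2 ⊎ Odd p
prime⇒≡2∨odd {p} pp with 2 ∣? p
... | no ¬2∣p = inj₂ ¬2∣p
... | yes 2∣p with prime⇒irreducible pp 2∣p
...   | inj₁ ()
...   | inj₂ 2≡p = inj₁ (sym 2≡p)

P*-odd⇒R≡p : ∀ p → P* p → Odd p → R (p ∸ 3) ≡ p
P*-odd⇒R≡p 0 (pp , _) _ = contradiction pp ¬prime[0]
P*-odd⇒R≡p 1 (pp , _) _ = contradiction pp ¬prime[1]
-- Here `2 ∸ 3` truncates to 0, and `R 0` is 1; oddness rules the case out.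
P*-odd⇒R≡p 2 _ odd = contradiction ∣-refl odd
P*-odd⇒R≡p (suc (suc (suc n))) p∈P* _ = P*⇒R≡3+n n p∈P*

-- The sum is `0! - 1!`, which is 0.
2∈P* : P* 2
2∈P* = prime[2] , (2 ∣0)

theorem5p1 : (∀ m → (∃[ n ] R n ≡ m) ⇔ (m ≡ 1 ⊎ P* m))
    × R 1 ≡ 2
    × (∀ p → P* p → Odd p → R (p ∸ 3) ≡ p)
    × (∀ n → n ≢ 1 → (∀ p → P* p → Odd p → n ≢ p ∸ 3) → R n ≡ 1)
-- `R 1 ≡ 2` holds by evaluation: `N 1` is 2 and `N 3` is 8.
theorem5p1 = (λ m → mk⇔ (value m) (attained m)) , refl , P*-odd⇒R≡p , otherwise
  where
  value : ∀ m → (∃[ n ] R n ≡ m) → m ≡ 1 ⊎ P* m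
  value m (n , R≡m) = case n ≟ 1 of λ where
    (yes refl) → inj₂ (subst P* R≡m 2∈P*)
    (no n≢1)   → Sum.map (trans (sym R≡m))
      (λ { (R≡p , p∈P*) → subst P* (trans (sym R≡p) R≡m) p∈P* }) (R-value n n≢1)

  attained : ∀ m → m ≡ 1 ⊎ P* m → ∃[ n ] R n ≡ m
  attained m (inj₁ refl) = 0 , refl
  attained m (inj₂ m∈P*@(pm , _)) with prime⇒≡2∨odd pm
  ... | inj₁ refl = 1 , refl
  ... | inj₂ odd  = m ∸ 3 , P*-odd⇒R≡p m m∈P* odd

  otherwise : ∀ n → n ≢ 1 → (∀ p → P* p → Odd p → n ≢ p ∸ 3) → R n ≡ 1
  otherwise n n≢1 avoids =
    [ id
    -- The prime `3 + n` cannot be 2, so it is odd, and `(3 + n) ∸ 3` reduces to the avoided `n`.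
    , (λ { (_ , p∈P*) → [ (λ ()) , (λ odd → contradiction refl (avoids (3 + n) p∈P* odd)) ]′
                          (prime⇒≡2∨odd (proj₁ p∈P*)) }) ]′
    (R-value n n≢1)
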